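{- For each positive integer $n$, let $\Gamma_n$ be the set of non-negative integers that can be expressed as a finite sum of squares of integers greater than or equal to $n$ (the empty sum being $0$), and let $F(\Gamma_n)$ denote the greatest integer not belonging to $\Gamma_n$. Then $F(\Gamma_n)=O(n^2)$; that is, there is a constant $C>0$ such that $F(\Gamma_n)\le C n^2$ for all positive integers $n$.
   Context: For every positive integer $n$ the set $\mathbb{N}\setminus\Gamma_n$ of non-negative integers not in $\Gamma_n$ is finite (since $\gcd(n^2,(n+1)^2)=1$), so $F(\Gamma_n)$ is well defined. -}

module Defs where

open import Data.Integer as ℤ using (ℤ; +_; -[1+_]; 0ℤ; +≤+; -≤+; -≤-)
import Data.Integer.Properties as ℤ
open import Data.List using (List; []; _∷_; foldr; map)
open import Data.List.Relation.Unary.All using (All; []; _∷_)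
open import Data.Nat using (ℕ; zero; suc; _+_; _*_; _∸_; _≤_; _<_; z≤n; s≤s; NonZero; _/_; _%_; _≤?_)
open import Data.Nat.DivMod using (m≡m%n+[m/n]*n; m%n<n)
open import Data.Nat.Induction using (<-rec)
open import Data.Nat.Properties
open import Data.Nat.Tactic.RingSolver using (solve-∀)
open import Data.Product using (∃-syntax; _×_; _,_; proj₁; proj₂)
open import Data.Sum using (_⊎_; inj₁; inj₂)
open import Level using (0ℓ)
open import Relation.Binary.PropositionalEquality
open import Relation.Nullary using (¬_; Dec; yes; no; contradiction)
open import Relation.Unary using (Pred; Decidable; _∈_; _∉_; ∁)

sumOfSquares : List ℤ → ℤ
sumOfSquares xs = foldr ℤ._+_ 0ℤ (map (ℤ._^ 2) xs)

-- Γ n lives in ℤ rather than ℕ because the greatest integer outside Γ 1 is -1.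
Γ : ℕ → Pred ℤ 0ℓ
Γ n m = ∃[ xs ] All (+ n ℤ.≤_) xs × sumOfSquares xs ≡ m

IsGreatest : Pred ℤ 0ℓ → ℤ → Set
IsGreatest P m = m ∈ P × (∀ k → k ∈ P → k ℤ.≤ m)

sq-pos : ∀ x → (+ x) ℤ.^ 2 ≡ + (x * x)
sq-pos x = trans (cong (+ x ℤ.*_) (ℤ.*-identityʳ (+ x))) (sym (ℤ.pos-* x x))

Γ-zero : ∀ {n} → + 0 ∈ Γ n
Γ-zero = [] , [] , refl

Γ-cons : ∀ {n a} x → n ≤ x → + a ∈ Γ n → + (x * x + a) ∈ Γ n
Γ-cons x n≤x (xs , all , eq) = + x ∷ xs , +≤+ n≤x ∷ all , cong₂ ℤ._+_ (sq-pos x) eq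

sumOfSquares-nonneg : ∀ {n xs} → All (+ n ℤ.≤_) xs → ∃[ a ] sumOfSquares xs ≡ + a
sumOfSquares-nonneg []                          = 0 , refl
sumOfSquares-nonneg (_∷_ {x = + x} _ all) with sumOfSquares-nonneg all
... | a , eq = x * x + a , cong₂ ℤ._+_ (sq-pos x) eq

Γ-neg : ∀ {n m} → -[1+ m ] ∉ Γ n
Γ-neg (xs , all , eq) with sumOfSquares-nonneg all
... | a , eq′ with trans (sym eq) eq′
...   | ()

Γ-uncons : ∀ {n m} → + m ∈ Γ n →
           m ≡ 0 ⊎ (∃[ x ] ∃[ a ] n ≤ x × + a ∈ Γ n × m ≡ x * x + a)
Γ-uncons ([] , [] , eq) = inj₁ (sym (ℤ.+-injective eq))
Γ-uncons (+ x ∷ xs , +≤+ n≤x ∷ all , eq) with sumOfSquares-nonneg all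
... | a , eq′ = inj₂ (x , a , n≤x , (xs , all , eq′) ,
                      ℤ.+-injective (trans (sym eq) (cong₂ ℤ._+_ (sq-pos x) eq′)))

Γ-+ : ∀ {n a b} → + a ∈ Γ n → + b ∈ Γ n → + (a + b) ∈ Γ n
Γ-+ {n} {a} {b} (xs , all , eq) b∈ = go all eq
  where
  go : ∀ {xs a} → All (+ n ℤ.≤_) xs → sumOfSquares xs ≡ + a → + (a + b) ∈ Γ n
  go [] refl = b∈
  go {a = a} (_∷_ {x = + x} (+≤+ n≤x) all) eq with sumOfSquares-nonneg all
  ... | c , eq′ = subst (λ i → + i ∈ Γ n) eq″ (Γ-cons x n≤x (go all eq′))
    where
    eq″ : x * x + (c + b) ≡ a + b
    eq″ = trans (sym (+-assoc (x * x) c b))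
            (cong (_+ b) (ℤ.+-injective (trans (sym (cong₂ ℤ._+_ (sq-pos x) eq′)) eq)))

Γ-* : ∀ {n a} q → + a ∈ Γ n → + (q * a) ∈ Γ n
Γ-* zero    a∈ = Γ-zero
Γ-* (suc q) a∈ = Γ-+ a∈ (Γ-* q a∈)

Γ-sq : ∀ {n} x → n ≤ x → + (x * x) ∈ Γ n
Γ-sq {n} x n≤x = subst (λ i → + i ∈ Γ n) (+-identityʳ (x * x)) (Γ-cons x n≤x Γ-zero)

-- Any m ≥ k² is (q ∸ r) k + r (k + 1), where m = q k + r with r < k ≤ q.
Γ-cofinite-from : ∀ {n} k .{{_ : NonZero k}} → + k ∈ Γ n → + suc k ∈ Γ n →
                  ∀ m → k * k ≤ m → + m ∈ Γ n
Γ-cofinite-from {n} k k∈ k+1∈ m kk≤m =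
  subst (λ i → + i ∈ Γ n) eq (Γ-+ (Γ-* (q ∸ r) k∈) (Γ-* r k+1∈))
  where
  q = m / k
  r = m % k
  k≤q : k ≤ q
  k≤q = ≮⇒≥ λ q<k → <⇒≱ (begin-strict
      m             ≡⟨ m≡m%n+[m/n]*n m k ⟩
      r + q * k     <⟨ +-monoˡ-< (q * k) (m%n<n m k) ⟩
      suc q * k     ≤⟨ *-monoˡ-≤ k q<k ⟩
      k * k         ∎) kk≤m
    where open ≤-Reasoning
  rearrange : ∀ d r k → d * k + r * suc k ≡ r + (d + r) * k
  rearrange = solve-∀
  eq : (q ∸ r) * k + r * suc k ≡ m
  eq = begin
    (q ∸ r) * k + r * suc k  ≡⟨ rearrange (q ∸ r) r k ⟩
    r + (q ∸ r + r) * k      ≡⟨ cong (λ i → r + i * k) (m∸n+n≡m (≤-trans (<⇒≤ (m%n<n m k)) k≤q)) ⟩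
    r + q * k                ≡⟨ m≡m%n+[m/n]*n m k ⟨
    m                        ∎
    where open ≡-Reasoning

-- The consecutive elements come from (2n - 1)(n + 1)² + 1 = (2n + 3)n².
Γ-cofinite : ∀ n .{{_ : NonZero n}} → ∃[ b ] (∀ m → b ≤ m → + m ∈ Γ n)
Γ-cofinite n@(suc p) = k * k , Γ-cofinite-from k k∈ k+1∈
  where
  k = suc (2 * p) * (suc n * suc n)
  k∈ : + k ∈ Γ n
  k∈ = Γ-* (suc (2 * p)) (Γ-sq (suc n) (n≤1+n n))
  identity : ∀ p → (2 * p + 5) * (suc p * suc p) ≡ suc (suc (2 * p) * (suc (suc p) * suc (suc p)))
  identity = solve-∀
  k+1∈ : + suc k ∈ Γ n
  k+1∈ = subst (λ i → + i ∈ Γ n) (identity p) (Γ-* (2 * p + 5) (Γ-sq n ≤-refl))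

Γ? : ∀ n .{{_ : NonZero n}} → Decidable (Γ n)
Γ? n (-[1+ m ]) = no Γ-neg
Γ? n@(suc _) (+ m) = <-rec (λ m → Dec (+ m ∈ Γ n)) step m
  where
  step : ∀ m → (∀ {a} → a < m → Dec (+ a ∈ Γ n)) → Dec (+ m ∈ Γ n)
  step zero    rec = yes Γ-zero
  step m@(suc _) rec with anyUpTo? first? (suc m)
    where
    First : ℕ → Set
    First x = n ≤ x × x * x ≤ m × + (m ∸ x * x) ∈ Γ n
    first? : ∀ x → Dec (First x)
    first? zero = no λ ()
    first? x@(suc _) with n ≤? x | x * x ≤? m
    ... | no n≰x  | _       = no λ f → n≰x (proj₁ f)
    ... | yes _   | no xx≰m = no λ f → xx≰m (proj₁ (proj₂ f))
    ... | yes n≤x | yes xx≤m with rec {m ∸ x * x} (∸-monoʳ-< {m} {x * x} {0} (s≤s z≤n) xx≤m)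
    ...   | yes a∈ = yes (n≤x , xx≤m , a∈)
    ...   | no a∉  = no λ f → a∉ (proj₂ (proj₂ f))
  ... | yes (x , _ , n≤x , xx≤m , a∈) =
    yes (subst (λ i → + i ∈ Γ n) (m+[n∸m]≡n xx≤m) (Γ-cons x n≤x a∈))
  ... | no none = no λ m∈ → impossible (Γ-uncons m∈)
    where
    impossible : ¬ (m ≡ 0 ⊎ (∃[ x ] ∃[ a ] n ≤ x × + a ∈ Γ n × m ≡ x * x + a))
    impossible (inj₂ (x@(suc _) , a , n≤x , a∈ , eq)) = none
      ( x
      , s≤s (≤-trans (m≤m*n x x) xx≤m)
      , n≤x
      , xx≤m
      , subst (λ i → + i ∈ Γ n) (sym (trans (cong (_∸ x * x) eq) (m+n∸m≡n (x * x) a))) a∈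
      )
      where
      xx≤m : x * x ≤ m
      xx≤m = subst (x * x ≤_) (sym eq) (m≤m+n (x * x) a)

greatestGap : ∀ n .{{_ : NonZero n}} → ∃[ f ] IsGreatest (∁ (Γ n)) f
greatestGap n = search (proj₁ (Γ-cofinite n)) (proj₂ (Γ-cofinite n))
  where
  search : ∀ b → (∀ m → b ≤ m → + m ∈ Γ n) → ∃[ f ] IsGreatest (∁ (Γ n)) f
  search zero above = -[1+ 0 ] , Γ-neg , greatest
    where
    greatest : ∀ k → k ∉ Γ n → k ℤ.≤ -[1+ 0 ]
    greatest (+ k)    k∉ = contradiction (above k z≤n) k∉
    greatest -[1+ k ] _  = -≤- z≤n
  search (suc b) above with Γ? n (+ b)
  ... | no b∉ = + b , b∉ , greatest
    where
    greatest : ∀ k → k ∉ Γ n → k ℤ.≤ + b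
    greatest (+ k)    k∉ = +≤+ (≮⇒≥ λ b<k → k∉ (above k b<k))
    greatest -[1+ k ] _  = -≤+
  ... | yes b∈ = search b above′
    where
    above′ : ∀ m → b ≤ m → + m ∈ Γ n
    above′ m b≤m with m≤n⇒m<n∨m≡n b≤m
    ... | inj₁ b<m  = above m b<m
    ... | inj₂ refl = b∈

F : ∀ n .{{_ : NonZero n}} → ℤ
F n = proj₁ (greatestGap n)

F-isGreatest : ∀ n .{{_ : NonZero n}} → IsGreatest (∁ (Γ n)) (F n)
F-isGreatest n = proj₂ (greatestGap n)

{-# OPTIONS --safe #-}

-- Every m ≥ 76 n² is a sum of squares of integers ≥ n.  Four pairs
-- (3n + a)² + (3n − a)² = 18 n² + 2 a² with a ≤ 2n use only integers ≥ n, and by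
-- Lagrange's four-square theorem the sums of such pairs are all 72 n² + 2h with h ≤ 4 n².
-- Adding n² or (n + 1)² adjusts the parity, and together these numbers contain n² consecutive
-- integers starting at 76 n²; further copies of n² reach everything above.
-- Lagrange's theorem is obtained by the classical descent on a multiple of a prime.
module Submission where

open import Defs
open import Data.Fin using (Fin; toℕ; splitAt; join)
open import Data.Fin.Properties
  using (pigeonhole; join-splitAt; toℕ-fromℕ<; toℕ≤pred[n]; toℕ-injective; <⇒≢)
import Data.Integer as ℤ
open import Data.Integer using (ℤ; +_; _≤_) renaming (∣_∣ to abs)
open import Data.Integer.DivMod using (_%ℕ_; _/ℕ_; n%ℕd<d; a≡a%ℕn+[a/ℕn]*n)
import Data.Integer.Divisibility.Signed as ℤ
import Data.Integer.Properties as ℤ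
import Data.Integer.Tactic.RingSolver as ℤ
open import Data.List.Relation.Unary.All using (All; []; _∷_)
import Data.Nat as ℕ
open import Data.Nat using (ℕ; zero; suc; NonZero; _^_; _<_; _>_; s≤s; z<s)
open import Data.Nat.Divisibility
  using (_∣_; divides; ∣-refl; ∣m+n∣m⇒∣n; ∣⇒≤; _∣0; n∣m*n; m∣m*n; m%n≡0⇒n∣m; n∣m⇒m%n≡0)
open import Data.Nat.DivMod
  using (_mod_; m≡m%n+[m/n]*n; m%n<n; %-distribˡ-+; %-remove-+ˡ)
open import Data.Nat.Induction using (<-rec)
open import Data.Nat.ListAction using (product)
open import Data.Nat.Primality
  using (Prime; euclidsLemma; prime⇒irreducible; ¬prime[1])
open import Data.Nat.Primality.Factorisation using (factorise; PrimeFactorisation)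
open import Data.Nat.Properties renaming (<⇒≢ to <⇒≢ℕ)
open import Data.Nat.Tactic.RingSolver using (solve-∀)
open import Data.Product using (∃-syntax; ∃₂; _×_; _,_; proj₁)
open import Data.Sum using (_⊎_; inj₁; inj₂; [_,_]′)
open import Function using (_∘_; Injective)
open import Relation.Binary.PropositionalEquality
open import Relation.Nullary using (¬_; yes; no; contradiction)
open import Relation.Unary using (_∈_; _∉_)

-- Euler's four-square identity.

module _ where
  open Data.Integer using (_+_; _-_; _*_)

  sum4 : ℤ → ℤ → ℤ → ℤ → ℤ
  sum4 a b c d = a * a + b * b + (c * c + d * d)

  -- These are the components of the quaternion product of the conjugate of `(a, b, c, d)` with
  -- `(x, y, z, w)`. Conjugation makes the last three alternating, so they are divisible by `m` when
  -- the two quadruples agree mod `m`.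
  dot i₂ i₃ i₄ : (a b c d x y z w : ℤ) → ℤ
  dot a b c d x y z w = a * x + b * y + (c * z + d * w)
  i₂  a b c d x y z w = a * y - b * x + (d * z - c * w)
  i₃  a b c d x y z w = a * z - c * x + (b * w - d * y)
  i₄  a b c d x y z w = a * w - d * x + (c * y - b * z)

  euler : ∀ a b c d x y z w →
    sum4 (dot a b c d x y z w) (i₂ a b c d x y z w) (i₃ a b c d x y z w) (i₄ a b c d x y z w) ≡
    sum4 a b c d * sum4 x y z w
  -- solve-∀ does not unfold sum4 and dot.
  euler = expanded
    where
      expanded : ∀ a b c d x y z w →
        (a * x + b * y + (c * z + d * w)) * (a * x + b * y + (c * z + d * w)) +
        (a * y - b * x + (d * z - c * w)) * (a * y - b * x + (d * z - c * w)) +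
        ((a * z - c * x + (b * w - d * y)) * (a * z - c * x + (b * w - d * y)) +
         (a * w - d * x + (c * y - b * z)) * (a * w - d * x + (c * y - b * z))) ≡
        (a * a + b * b + (c * c + d * d)) * (x * x + y * y + (z * z + w * w))
      expanded = ℤ.solve-∀

  -- Reduction mod `m` enters here: the cofactor of `m` is 2 (b · k) + m (k · k). Writing `b₁ + b₁`
  -- keeps it in terms of the doubled residues, for which bounds are available.
  sum4-shift : ∀ m b₁ b₂ b₃ b₄ k₁ k₂ k₃ k₄ →
    (b₁ + m * k₁) * (b₁ + m * k₁) + (b₂ + m * k₂) * (b₂ + m * k₂) +
    ((b₃ + m * k₃) * (b₃ + m * k₃) + (b₄ + m * k₄) * (b₄ + m * k₄)) ≡
    b₁ * b₁ + b₂ * b₂ + (b₃ * b₃ + b₄ * b₄) +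
    m * ((b₁ + b₁) * k₁ + (b₂ + b₂) * k₂ + ((b₃ + b₃) * k₃ + (b₄ + b₄) * k₄) +
         m * (k₁ * k₁ + k₂ * k₂ + (k₃ * k₃ + k₄ * k₄)))
  sum4-shift = ℤ.solve-∀

open Data.Nat using (_+_; _*_; _∸_; _/_; _%_)

data FourSquares (n : ℕ) : Set where
  fourSquares : ∀ a b c d → sum4 a b c d ≡ + n → FourSquares n

FourSquares-* : ∀ {m n} → FourSquares m → FourSquares n → FourSquares (m * n)
FourSquares-* {m} {n} (fourSquares a b c d eq) (fourSquares x y z w eq′) =
  fourSquares (dot a b c d x y z w) (i₂ a b c d x y z w) (i₃ a b c d x y z w) (i₄ a b c d x y z w)
    (trans (euler a b c d x y z w) (trans (cong₂ ℤ._*_ eq eq′) (sym (ℤ.pos-* m n))))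

-- Balanced residues and the descent on a multiple of a prime.

balancedResidue : ∀ m .{{_ : NonZero m}} (a : ℤ) →
                  ∃₂ λ b k → a ≡ b ℤ.+ + m ℤ.* k × abs (b ℤ.+ b) ℕ.≤ m
balancedResidue m a with (a %ℕ m) + (a %ℕ m) ≤? m
... | yes 2r≤m = + (a %ℕ m) , a /ℕ m ,
  trans (a≡a%ℕn+[a/ℕn]*n a m) (cong (ℤ._+_ (+ (a %ℕ m))) (ℤ.*-comm (a /ℕ m) (+ m))) , 2r≤m
-- The remainder exceeds m / 2, so subtracting `m` gives the representative of smaller absolute
-- value.
... | no 2r≰m = r ℤ.- + m , q ℤ.+ (+ 1) , trans (a≡a%ℕn+[a/ℕn]*n a m) (shift r (+ m) q) , bound
  where
  r = + (a %ℕ m)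
  q = a /ℕ m
  shift : ∀ r m q → r ℤ.+ q ℤ.* m ≡ r ℤ.- m ℤ.+ m ℤ.* (q ℤ.+ + 1)
  shift = ℤ.solve-∀
  r<m = n%ℕd<d a m
  gap = m ∸ a %ℕ m
  gap≡ : abs (r ℤ.- + m) ≡ gap
  gap≡ = trans (cong abs (ℤ.m-n≡m⊖n (a %ℕ m) m)) (ℤ.∣⊖∣-≤ (<⇒≤ r<m))
  bound : abs ((r ℤ.- + m) ℤ.+ (r ℤ.- + m)) ℕ.≤ m
  bound = begin
    abs ((r ℤ.- + m) ℤ.+ (r ℤ.- + m)) ≤⟨ ℤ.∣i+j∣≤∣i∣+∣j∣ (r ℤ.- + m) (r ℤ.- + m) ⟩
    abs (r ℤ.- + m) + abs (r ℤ.- + m) ≡⟨ cong₂ _+_ gap≡ gap≡ ⟩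
    gap + gap                         ≤⟨ +-cancelʳ-≤ m (gap + gap) m (begin
      gap + gap + m                     ≤⟨ +-monoʳ-≤ (gap + gap) (≰⇒≥ 2r≰m) ⟩
      gap + gap + (a %ℕ m + a %ℕ m)     ≡⟨ interchange gap (a %ℕ m) ⟩
      (gap + a %ℕ m) + (gap + a %ℕ m)   ≡⟨ cong₂ _+_ gap+r gap+r ⟩
      m + m                             ∎) ⟩
    m                                 ∎
    where
    open ≤-Reasoning
    gap+r = m∸n+n≡m (<⇒≤ r<m)
    interchange : ∀ g r → g + g + (r + r) ≡ (g + r) + (g + r)
    interchange = solve-∀

+-tight : ∀ {a b c d} → a ℕ.≤ b → c ℕ.≤ d → a + c ≡ b + d → a ≡ b × c ≡ d
+-tight a≤b c≤d eq with m≤n⇒m<n∨m≡n a≤b | m≤n⇒m<n∨m≡n c≤d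
... | inj₁ a<b  | _         = contradiction eq (<⇒≢ℕ (+-mono-<-≤ a<b c≤d))
... | inj₂ _    | inj₁ c<d  = contradiction eq (<⇒≢ℕ (+-mono-≤-< a≤b c<d))
... | inj₂ refl | inj₂ refl = refl , refl

m*m≤n*n⇒m≤n : ∀ {m n} → m * m ℕ.≤ n * n → m ℕ.≤ n
m*m≤n*n⇒m≤n mm≤nn = ≮⇒≥ λ n<m → <⇒≱ (*-mono-< n<m n<m) mm≤nn

m*m≡n*n⇒m≡n : ∀ {m n} → m * m ≡ n * n → m ≡ n
m*m≡n*n⇒m≡n eq =
  ≤-antisym (m*m≤n*n⇒m≤n (≤-reflexive eq)) (m*m≤n*n⇒m≤n (≤-reflexive (sym eq)))

Σsq : ℕ → ℕ → ℕ → ℕ → ℕ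
Σsq a b c d = a * a + b * b + (c * c + d * d)

module _ {a b c d m} (a≤m : a ℕ.≤ m) (b≤m : b ℕ.≤ m) (c≤m : c ℕ.≤ m) (d≤m : d ℕ.≤ m) where

  Σsq-mono : Σsq a b c d ℕ.≤ Σsq m m m m
  Σsq-mono = +-mono-≤ (+-mono-≤ (*-mono-≤ a≤m a≤m) (*-mono-≤ b≤m b≤m))
                      (+-mono-≤ (*-mono-≤ c≤m c≤m) (*-mono-≤ d≤m d≤m))

  -- Slack in any one term would make the whole sum strictly smaller. This settles the case `q ≡ m`
  -- of the descent.
  Σsq-tight : Σsq a b c d ≡ Σsq m m m m → a ≡ m × b ≡ m × c ≡ m × d ≡ m
  Σsq-tight eq
    with ab , cd ← +-tight (+-mono-≤ (*-mono-≤ a≤m a≤m) (*-mono-≤ b≤m b≤m))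
                           (+-mono-≤ (*-mono-≤ c≤m c≤m) (*-mono-≤ d≤m d≤m)) eq
    with a≡ , b≡ ← +-tight (*-mono-≤ a≤m a≤m) (*-mono-≤ b≤m b≤m) ab
       | c≡ , d≡ ← +-tight (*-mono-≤ c≤m c≤m) (*-mono-≤ d≤m d≤m) cd
    = m*m≡n*n⇒m≡n a≡ , m*m≡n*n⇒m≡n b≡ , m*m≡n*n⇒m≡n c≡ , m*m≡n*n⇒m≡n d≡

Σsq-zero : ∀ a b c d → Σsq a b c d ≡ 0 → a ≡ 0 × b ≡ 0 × c ≡ 0 × d ≡ 0
Σsq-zero a b c d eq =
  root (m+n≡0⇒m≡0 (a * a) ab) , root (m+n≡0⇒n≡0 (a * a) ab) ,
  root (m+n≡0⇒m≡0 (c * c) cd) , root (m+n≡0⇒n≡0 (c * c) cd)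
  where
  ab = m+n≡0⇒m≡0 (a * a + b * b) eq
  cd = m+n≡0⇒n≡0 (a * a + b * b) eq
  root : ∀ {x} → x * x ≡ 0 → x ≡ 0
  root {zero} _ = refl

sum4-abs : ∀ a b c d → sum4 a b c d ≡ + Σsq (abs a) (abs b) (abs c) (abs d)
sum4-abs a b c d = cong₂ ℤ._+_ (cong₂ ℤ._+_ (square a) (square b)) (cong₂ ℤ._+_ (square c) (square d))
  where
  square : ∀ a → a ℤ.* a ≡ + (abs a * abs a)
  square (+ n)      = sym (ℤ.pos-* n n)
  square ℤ.-[1+ n ] = refl

-- Write aᵢ = bᵢ + m kᵢ with 2 |bᵢ| ≤ m and Σ bᵢ² = m q. Dividing Euler's representation of
-- Σ bᵢ² · Σ aᵢ² = m² q p by m leaves q + b · k and the three other components for b and k.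
descentStep : ∀ {p} m .{{_ : NonZero m}} → FourSquares (m * p) →
              ∃[ q ] q ℕ.≤ m × FourSquares (q * p) × (q ≡ 0 ⊎ q ≡ m → m ∣ p)
descentStep {p} m (fourSquares a₁ a₂ a₃ a₄ eq)
  with b₁ , k₁ , refl , 2b₁≤m ← balancedResidue m a₁
     | b₂ , k₂ , refl , 2b₂≤m ← balancedResidue m a₂
     | b₃ , k₃ , refl , 2b₃≤m ← balancedResidue m a₃
     | b₄ , k₄ , refl , 2b₄≤m ← balancedResidue m a₄
  = q , q≤m , fourSquares (+ q ℤ.+ B∙K) c₂ c₃ c₄ represents , extremal
  where
  s = Σsq (abs b₁) (abs b₂) (abs b₃) (abs b₄)
  P = dot (b₁ ℤ.+ b₁) (b₂ ℤ.+ b₂) (b₃ ℤ.+ b₃) (b₄ ℤ.+ b₄) k₁ k₂ k₃ k₄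
  M = sum4 k₁ k₂ k₃ k₄
  -- The shift identity solved for the integer `z` with Σ bᵢ² = m z. As the left side is a natural
  -- number and `m` is positive, `z` equals its absolute value `q`.
  z = + p ℤ.- (P ℤ.+ + m ℤ.* M)
  q = abs z

  solveFor : ∀ s m p t → s ℤ.+ m ℤ.* t ≡ m ℤ.* p → s ≡ m ℤ.* (p ℤ.- t)
  solveFor s m p t eq = trans (sym (ring₁ s (m ℤ.* t))) (trans (cong (ℤ._- (m ℤ.* t)) eq) (ring₂ m p t))
    where
    ring₁ : ∀ s u → s ℤ.+ u ℤ.- u ≡ s
    ring₁ = ℤ.solve-∀
    ring₂ : ∀ m p t → m ℤ.* p ℤ.- m ℤ.* t ≡ m ℤ.* (p ℤ.- t)
    ring₂ = ℤ.solve-∀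

  b-norm : sum4 b₁ b₂ b₃ b₄ ≡ + m ℤ.* z
  b-norm = solveFor _ (+ m) (+ p) (P ℤ.+ + m ℤ.* M)
    (trans (sym (sum4-shift (+ m) b₁ b₂ b₃ b₄ k₁ k₂ k₃ k₄)) (trans eq (ℤ.pos-* m p)))

  s≡mz : + s ≡ + m ℤ.* z
  s≡mz = trans (sym (sum4-abs b₁ b₂ b₃ b₄)) b-norm

  s≡mq : s ≡ m * q
  s≡mq = trans (cong abs s≡mz) (ℤ.abs-* (+ m) z)

  z≡q : z ≡ + q
  z≡q = ℤ.*-cancelˡ-≡ (+ m) z (+ q) (trans (sym s≡mz) (trans (cong +_ s≡mq) (ℤ.pos-* m q)))
    where instance _ = ℤ.≢-nonZero {+ m} (ℕ.≢-nonZero⁻¹ m ∘ ℤ.+-injective)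

  -- Comparing the doubled residues with `m` gives 4 m q ≤ 4 m² without halving `m`, so both
  -- parities of `m` are treated alike.
  2b = Σsq (abs (b₁ ℤ.+ b₁)) (abs (b₂ ℤ.+ b₂)) (abs (b₃ ℤ.+ b₃)) (abs (b₄ ℤ.+ b₄))

  2b≡4mq : 2b ≡ 4 * (m * q)
  2b≡4mq = trans (ℤ.+-injective (begin
    + 2b
      ≡⟨ sum4-abs (b₁ ℤ.+ b₁) (b₂ ℤ.+ b₂) (b₃ ℤ.+ b₃) (b₄ ℤ.+ b₄) ⟨
    sum4 (b₁ ℤ.+ b₁) (b₂ ℤ.+ b₂) (b₃ ℤ.+ b₃) (b₄ ℤ.+ b₄)
      ≡⟨ quadruple b₁ b₂ b₃ b₄ ⟩
    + 4 ℤ.* sum4 b₁ b₂ b₃ b₄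
      ≡⟨ cong (+ 4 ℤ.*_) (sum4-abs b₁ b₂ b₃ b₄) ⟩
    + 4 ℤ.* + s
      ≡⟨ ℤ.pos-* 4 s ⟨
    + (4 * s)
      ∎)) (cong (4 *_) s≡mq)
    where
    open ≡-Reasoning
    quadruple : ∀ a b c d →
      (a ℤ.+ a) ℤ.* (a ℤ.+ a) ℤ.+ (b ℤ.+ b) ℤ.* (b ℤ.+ b) ℤ.+
      ((c ℤ.+ c) ℤ.* (c ℤ.+ c) ℤ.+ (d ℤ.+ d) ℤ.* (d ℤ.+ d)) ≡
      + 4 ℤ.* (a ℤ.* a ℤ.+ b ℤ.* b ℤ.+ (c ℤ.* c ℤ.+ d ℤ.* d))
    quadruple = ℤ.solve-∀

  4mm : ∀ m → Σsq m m m m ≡ 4 * (m * m)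
  4mm = expand
    where
    expand : ∀ m → m * m + m * m + (m * m + m * m) ≡ 4 * (m * m)
    expand = solve-∀

  q≤m : q ℕ.≤ m
  q≤m = *-cancelˡ-≤ m (*-cancelˡ-≤ 4 (begin
    4 * (m * q)   ≡⟨ 2b≡4mq ⟨
    2b            ≤⟨ Σsq-mono 2b₁≤m 2b₂≤m 2b₃≤m 2b₄≤m ⟩
    Σsq m m m m   ≡⟨ 4mm m ⟩
    4 * (m * m)   ∎))
    where open ≤-Reasoning

  p≡ : + p ≡ + q ℤ.+ (P ℤ.+ + m ℤ.* M)
  p≡ = trans (sym (ring (+ p) (P ℤ.+ + m ℤ.* M))) (cong (ℤ._+ (P ℤ.+ + m ℤ.* M)) z≡q)
    where
    ring : ∀ p t → p ℤ.- t ℤ.+ t ≡ p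
    ring = ℤ.solve-∀

  -- By `p≡`, p = q + P + m M, and every term of `P` contains a doubled residue.
  m∣p-if : m ∣ q → m ∣ abs (b₁ ℤ.+ b₁) → m ∣ abs (b₂ ℤ.+ b₂) →
           m ∣ abs (b₃ ℤ.+ b₃) → m ∣ abs (b₄ ℤ.+ b₄) → m ∣ p
  m∣p-if m∣q m∣₁ m∣₂ m∣₃ m∣₄ = ℤ.∣⇒∣ᵤ (subst (+ m ℤ.∣_) (sym p≡)
    (ℤ.∣m∣n⇒∣m+n {+ m} {+ q} {P ℤ.+ + m ℤ.* M} (ℤ.∣ᵤ⇒∣ {+ m} {+ q} m∣q)
      (ℤ.∣m∣n⇒∣m+n {+ m} {P} {+ m ℤ.* M} m∣P (ℤ.∣m⇒∣m*n {+ m} {+ m} M ℤ.∣-refl))))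
    where
    term : ∀ b k → m ∣ abs b → + m ℤ.∣ b ℤ.* k
    term b k m∣b = ℤ.∣m⇒∣m*n {+ m} {b} k (ℤ.∣ᵤ⇒∣ {+ m} {b} m∣b)
    sum : ∀ {x y} → + m ℤ.∣ x → + m ℤ.∣ y → + m ℤ.∣ x ℤ.+ y
    sum = ℤ.∣m∣n⇒∣m+n
    m∣P : + m ℤ.∣ P
    m∣P = sum (sum (term (b₁ ℤ.+ b₁) k₁ m∣₁) (term (b₂ ℤ.+ b₂) k₂ m∣₂))
              (sum (term (b₃ ℤ.+ b₃) k₃ m∣₃) (term (b₄ ℤ.+ b₄) k₄ m∣₄))

  -- If q = 0, all doubled residues vanish. If q = m, which can occur only for even `m`, they all
  -- have absolute value `m`. Either way `m` divides them and `q`.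
  extremal : q ≡ 0 ⊎ q ≡ m → m ∣ p
  extremal (inj₁ q≡0) =
    let e₁ , e₂ , e₃ , e₄ = Σsq-zero
          (abs (b₁ ℤ.+ b₁)) (abs (b₂ ℤ.+ b₂)) (abs (b₃ ℤ.+ b₃)) (abs (b₄ ℤ.+ b₄))
          (trans 2b≡4mq (trans (cong (λ q → 4 * (m * q)) q≡0) (cong (4 *_) (*-zeroʳ m))))
    in m∣p-if (m∣0 q≡0) (m∣0 e₁) (m∣0 e₂) (m∣0 e₃) (m∣0 e₄)
    where
    m∣0 : ∀ {x} → x ≡ 0 → m ∣ x
    m∣0 refl = m ∣0
  extremal (inj₂ q≡m) =
    let e₁ , e₂ , e₃ , e₄ = Σsq-tight 2b₁≤m 2b₂≤m 2b₃≤m 2b₄≤m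
          (trans 2b≡4mq (trans (cong (λ q → 4 * (m * q)) q≡m) (sym (4mm m))))
    in m∣p-if (m∣m q≡m) (m∣m e₁) (m∣m e₂) (m∣m e₃) (m∣m e₄)
    where
    m∣m : ∀ {x} → x ≡ m → m ∣ x
    m∣m refl = ∣-refl

  B∙K = dot b₁ b₂ b₃ b₄ k₁ k₂ k₃ k₄

  c₂ = i₂ b₁ b₂ b₃ b₄ k₁ k₂ k₃ k₄
  c₃ = i₃ b₁ b₂ b₃ b₄ k₁ k₂ k₃ k₄
  c₄ = i₄ b₁ b₂ b₃ b₄ k₁ k₂ k₃ k₄

  -- No division by `m` takes place: expanding the first square and applying `euler` to `b` and `k`,
  -- with Σ bᵢ² = m q, gives q (q + 2 (b · k) + m M), whose second factor is `p`.
  represents : sum4 (+ q ℤ.+ B∙K) c₂ c₃ c₄ ≡ + (q * p)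
  represents = begin
    sum4 (+ q ℤ.+ B∙K) c₂ c₃ c₄
      ≡⟨ firstShift (+ q) B∙K c₂ c₃ c₄ ⟩
    + q ℤ.* (+ q ℤ.+ (+ 2 ℤ.* B∙K)) ℤ.+ sum4 B∙K c₂ c₃ c₄
      ≡⟨ cong (ℤ._+_ (+ q ℤ.* (+ q ℤ.+ (+ 2 ℤ.* B∙K))))
           (trans (euler b₁ b₂ b₃ b₄ k₁ k₂ k₃ k₄)
                  (cong (ℤ._* M) (trans b-norm (cong (+ m ℤ.*_) z≡q)))) ⟩
    + q ℤ.* (+ q ℤ.+ (+ 2 ℤ.* B∙K)) ℤ.+ + m ℤ.* + q ℤ.* M
      ≡⟨ collect (+ m) (+ q) B∙K M ⟩
    + q ℤ.* (+ q ℤ.+ (+ 2 ℤ.* B∙K ℤ.+ + m ℤ.* M))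
      ≡⟨ cong (λ t → + q ℤ.* (+ q ℤ.+ (t ℤ.+ + m ℤ.* M))) (double b₁ b₂ b₃ b₄ k₁ k₂ k₃ k₄) ⟩
    + q ℤ.* (+ q ℤ.+ (P ℤ.+ + m ℤ.* M))
      ≡⟨ cong (+ q ℤ.*_) p≡ ⟨
    + q ℤ.* + p
      ≡⟨ ℤ.pos-* q p ⟨
    + (q * p)
      ∎
    where
    open ≡-Reasoning
    firstShift : ∀ q x y z w →
      (q ℤ.+ x) ℤ.* (q ℤ.+ x) ℤ.+ y ℤ.* y ℤ.+ (z ℤ.* z ℤ.+ w ℤ.* w) ≡
      q ℤ.* (q ℤ.+ (+ 2 ℤ.* x)) ℤ.+ (x ℤ.* x ℤ.+ y ℤ.* y ℤ.+ (z ℤ.* z ℤ.+ w ℤ.* w))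
    firstShift = ℤ.solve-∀
    collect : ∀ m q x M → q ℤ.* (q ℤ.+ (+ 2 ℤ.* x)) ℤ.+ m ℤ.* q ℤ.* M ≡
                          q ℤ.* (q ℤ.+ (+ 2 ℤ.* x ℤ.+ m ℤ.* M))
    collect = ℤ.solve-∀
    double : ∀ a b c d x y z w →
      + 2 ℤ.* (a ℤ.* x ℤ.+ b ℤ.* y ℤ.+ (c ℤ.* z ℤ.+ d ℤ.* w)) ≡
      (a ℤ.+ a) ℤ.* x ℤ.+ (b ℤ.+ b) ℤ.* y ℤ.+ ((c ℤ.+ c) ℤ.* z ℤ.+ (d ℤ.+ d) ℤ.* w)
    double = ℤ.solve-∀

-- In `descentStep`, q = 0 or q = m would make `m` a divisor of the prime `p` with 1 < m < p. So the
-- multiplier stays positive and strictly decreases until it is 1.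
descent : ∀ {p} → Prime p → ∀ m → 0 < m → m < p → FourSquares (m * p) → FourSquares p
descent {p} p-prime = <-rec (λ m → 0 < m → m < p → FourSquares (m * p) → FourSquares p) step
  where
  m∤p : ∀ {m} → 1 < m → m < p → ¬ m ∣ p
  m∤p 1<m m<p m∣p with prime⇒irreducible p-prime m∣p
  ... | inj₁ refl = <-irrefl refl 1<m
  ... | inj₂ refl = <-irrefl refl m<p

  step : ∀ m → (∀ {q} → q < m → 0 < q → q < p → FourSquares (q * p) → FourSquares p) →
         0 < m → m < p → FourSquares (m * p) → FourSquares p
  step 1 _ _ _ p∈ = subst FourSquares (*-identityˡ p) p∈
  step m@(suc (suc _)) rec _ m<p mp∈ with descentStep {p} m mp∈
  ... | q , q≤m , qp∈ , extremal with q ℕ.≟ 0 | q ℕ.≟ m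
  ...   | no q≢0  | no q≢m = rec q<m (n≢0⇒n>0 q≢0) (<-trans q<m m<p) qp∈
    where q<m = ≤∧≢⇒< q≤m q≢m
  ...   | yes q≡0 | _       = contradiction (extremal (inj₁ q≡0)) (m∤p (s≤s z<s) m<p)
  ...   | no _    | yes q≡m = contradiction (extremal (inj₂ q≡m)) (m∤p (s≤s z<s) m<p)

-- A small multiple of an odd prime as a sum of four squares.

collision : ∀ {m n p} (f : Fin m → Fin p) (g : Fin n → Fin p) →
            Injective _≡_ _≡_ f → Injective _≡_ _≡_ g → p < m + n → ∃₂ λ i j → f i ≡ g j
collision {m} {n} f g f-inj g-inj p<m+n
  with i , j , i<j , eq ← pigeonhole p<m+n ([ f , g ]′ ∘ splitAt m)
  -- The colliding indices are distinct, and remain so after `splitAt` since `join` inverts it.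
  -- Injectivity of `f` and of `g` then puts them in different summands.
  = go (splitAt m i) (splitAt m j) eq
       (λ eq′ → <⇒≢ i<j (trans (sym (join-splitAt m n i))
                               (trans (cong (join m n) eq′) (join-splitAt m n j))))
  where
  go : ∀ x y → [ f , g ]′ x ≡ [ f , g ]′ y → x ≢ y → ∃₂ λ i j → f i ≡ g j
  go (inj₁ i) (inj₁ j) eq x≢y = contradiction (cong inj₁ (f-inj eq)) x≢y
  go (inj₁ i) (inj₂ j) eq x≢y = i , j , eq
  go (inj₂ i) (inj₁ j) eq x≢y = j , i , sym eq
  go (inj₂ i) (inj₂ j) eq x≢y = contradiction (cong inj₂ (g-inj eq)) x≢y

module _ {p} .{{_ : NonZero p}} where

  ≡%⇒∣ : ∀ a d → a % p ≡ (a + d) % p → p ∣ d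
  ≡%⇒∣ a d eq = ∣m+n∣m⇒∣n (divides ((a + d) / p) (+-cancelˡ-≡ (a % p) _ _ (begin
    a % p + (a / p * p + d)           ≡⟨ +-assoc (a % p) _ d ⟨
    a % p + a / p * p + d             ≡⟨ cong (_+ d) (m≡m%n+[m/n]*n a p) ⟨
    a + d                             ≡⟨ m≡m%n+[m/n]*n (a + d) p ⟩
    (a + d) % p + (a + d) / p * p     ≡⟨ cong (_+ (a + d) / p * p) eq ⟨
    a % p + (a + d) / p * p           ∎))) (n∣m*n (a / p))
    where open ≡-Reasoning

  %-+-congˡ : ∀ {a b} c → a % p ≡ b % p → (c + a) % p ≡ (c + b) % p
  %-+-congˡ {a} {b} c eq = begin
    (c + a) % p           ≡⟨ %-distribˡ-+ c a p ⟩
    (c % p + a % p) % p   ≡⟨ cong (λ r → (c % p + r) % p) eq ⟩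
    (c % p + b % p) % p   ≡⟨ %-distribˡ-+ c b p ⟨
    (c + b) % p           ∎
    where open ≡-Reasoning

  mod≡⇒%≡ : ∀ a b → a mod p ≡ b mod p → a % p ≡ b % p
  mod≡⇒%≡ a b eq =
    trans (sym (toℕ-fromℕ< (m%n<n a p))) (trans (cong toℕ eq) (toℕ-fromℕ< (m%n<n b p)))

module OddPrime h (p-prime : Prime (suc (h + h))) where

  p = suc (h + h)

  -- With y = x + d, the difference of squares is d (2x + d). The prime `p` would divide a factor,
  -- but for d > 0 both factors are positive and at most 2h < p. The offset `c` is 0 for `f` and 1
  -- for `g`.
  square-injective-≤ : ∀ c {x y} → x ℕ.≤ y → y ℕ.≤ h →
                       (c + x * x) % p ≡ (c + y * y) % p → x ≡ y
  square-injective-≤ c {x} x≤y y≤h eq with m≤n⇒∃[o]m+o≡n x≤y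
  ... | zero      , refl = sym (+-identityʳ x)
  ... | d@(suc _) , refl
    with euclidsLemma d (x + (x + d)) p-prime
           (≡%⇒∣ (c + x * x) _ (trans eq (cong (_% p) (difference c x d))))
    where
    difference : ∀ c x d → c + (x + d) * (x + d) ≡ c + x * x + d * (x + (x + d))
    difference = solve-∀
  ...   | inj₁ p∣d = contradiction (∣⇒≤ p∣d)
    (<⇒≱ (s≤s (≤-trans (m≤n+m d x) (≤-trans y≤h (m≤m+n h h)))))
  ...   | inj₂ p∣s = contradiction
    (∣⇒≤ {{ℕ.>-nonZero (<-≤-trans z<s (≤-trans (m≤n+m d x) (m≤n+m (x + d) x)))}} p∣s)
    (<⇒≱ (s≤s (+-mono-≤ (≤-trans x≤y y≤h) y≤h)))

  square-injective : ∀ c {x y} → x ℕ.≤ h → y ℕ.≤ h → (c + x * x) % p ≡ (c + y * y) % p → x ≡ y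
  square-injective c {x} {y} x≤h y≤h eq with ≤-total x y
  ... | inj₁ x≤y = square-injective-≤ c x≤y y≤h eq
  ... | inj₂ y≤x = sym (square-injective-≤ c y≤x x≤h (sym eq))

  -- Since h + h = p - 1, multiplication by it is negation mod `p`, expressed in natural numbers.
  -- Adding u + v to both sides cancels it up to multiples of `p`.
  negation-injective : ∀ u v → ((h + h) * u) % p ≡ ((h + h) * v) % p → u % p ≡ v % p
  negation-injective u v eq = begin
    u % p                        ≡⟨ %-remove-+ˡ u (m∣m*n v) ⟨
    (p * v + u) % p              ≡⟨ cong (_% p) (ring (h + h) u v) ⟨
    (u + v + (h + h) * v) % p    ≡⟨ %-+-congˡ (u + v) eq ⟨
    (u + v + (h + h) * u) % p    ≡⟨ cong (λ s → (s + (h + h) * u) % p) (+-comm u v) ⟩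
    (v + u + (h + h) * u) % p    ≡⟨ cong (_% p) (ring (h + h) v u) ⟩
    (p * u + v) % p              ≡⟨ %-remove-+ˡ v (m∣m*n u) ⟩
    v % p                        ∎
    where
    open ≡-Reasoning
    ring : ∀ t u v → u + v + t * v ≡ suc t * v + u
    ring = solve-∀

  f g : Fin (suc h) → Fin p
  f i = (toℕ i * toℕ i) mod p
  g j = ((h + h) * (1 + toℕ j * toℕ j)) mod p

  f-injective : Injective _≡_ _≡_ f
  f-injective {i} {j} eq = toℕ-injective
    (square-injective 0 (toℕ≤pred[n] i) (toℕ≤pred[n] j)
      (mod≡⇒%≡ (toℕ i * toℕ i) (toℕ j * toℕ j) eq))

  g-injective : Injective _≡_ _≡_ g
  g-injective {i} {j} eq = toℕ-injective
    (square-injective 1 (toℕ≤pred[n] i) (toℕ≤pred[n] j)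
      (negation-injective (1 + toℕ i * toℕ i) (1 + toℕ j * toℕ j)
        (mod≡⇒%≡ ((h + h) * (1 + toℕ i * toℕ i)) ((h + h) * (1 + toℕ j * toℕ j)) eq)))

  -- x² and -(1 + y²) each take h + 1 values mod p for 0 ≤ x, y ≤ h, so they share one.
  p∣x²+1+y² : ∃₂ λ x y → x ℕ.≤ h × y ℕ.≤ h × p ∣ x * x + (1 + y * y)
  p∣x²+1+y²
    with i , j , eq ← collision f g f-injective g-injective (s≤s (≤-reflexive (sym (+-suc h h))))
    = toℕ i , toℕ j , toℕ≤pred[n] i , toℕ≤pred[n] j , m%n≡0⇒n∣m _ p (begin
        (x * x + u) % p                ≡⟨ cong (_% p) (+-comm (x * x) u) ⟩
        (u + x * x) % p                ≡⟨ %-+-congˡ {a = x * x} u (mod≡⇒%≡ (x * x) ((h + h) * u) eq) ⟩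
        (u + (h + h) * u) % p          ≡⟨ n∣m⇒m%n≡0 (p * u) p (m∣m*n u) ⟩
        0                              ∎)
    where
    open ≡-Reasoning
    x = toℕ i
    u = 1 + toℕ j * toℕ j

  -- The sum x² + 1² + y² + 0² is a positive multiple m p, and it is at most 2h² + 1 < p², so `m`
  -- lies in the range required by `descent`.
  primeFourSquares-from : (∃₂ λ x y → x ℕ.≤ h × y ℕ.≤ h × p ∣ x * x + (1 + y * y)) →
                          FourSquares p
  primeFourSquares-from (x , y , x≤h , y≤h , divides m eq) = descent p-prime m m>0 m<p
    (fourSquares (+ x) (+ 1) (+ y) (+ 0)
      (trans (sum4-abs (+ x) (+ 1) (+ y) (+ 0)) (cong +_ (trans (ring x y) eq))))
    where
    ring : ∀ x y → x * x + 1 * 1 + (y * y + 0 * 0) ≡ x * x + (1 + y * y)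
    ring = solve-∀
    m>0 : 0 < m
    m>0 = n≢0⇒n>0 λ m≡0 → 1+n≢0 (m+n≡0⇒n≡0 (x * x) (trans eq (cong (_* p) m≡0)))
    expand : ∀ h → suc (h + h) * suc (h + h) ≡
                   h * h + (1 + h * h) + (h + h + (h + h) + (h * h + h * h))
    expand = solve-∀
    -- For h = 0 both sides of `bound` would be 1.
    h>0 : 0 < h
    h>0 = n≢0⇒n>0 λ { refl → ¬prime[1] p-prime }
    bound : h * h + (1 + h * h) < p * p
    bound = subst (h * h + (1 + h * h) <_) (sym (expand h))
      (m<m+n (h * h + (1 + h * h))
        (<-≤-trans h>0 (≤-trans (m≤m+n h h) (≤-trans (m≤m+n (h + h) (h + h)) (m≤m+n _ _)))))
    m<p : m < p
    m<p = *-cancelʳ-< p m p (begin-strict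
      m * p                  ≡⟨ eq ⟨
      x * x + (1 + y * y)    ≤⟨ +-mono-≤ (*-mono-≤ x≤h x≤h) (s≤s (*-mono-≤ y≤h y≤h)) ⟩
      h * h + (1 + h * h)    <⟨ bound ⟩
      p * p                  ∎)
      where
      open ≤-Reasoning

  primeFourSquares : FourSquares p
  primeFourSquares = primeFourSquares-from p∣x²+1+y²

-- Lagrange's theorem from the case of primes.

parity : ∀ n → ∃[ h ] (n ≡ h + h ⊎ n ≡ suc (h + h))
parity zero = 0 , inj₁ refl
parity (suc n) with parity n
... | h , inj₁ refl = h , inj₂ refl
... | h , inj₂ refl = suc h , inj₁ (cong suc (sym (+-suc h h)))

prime⇒fourSquares : ∀ {p} → Prime p → FourSquares p
prime⇒fourSquares {p} p-prime with parity p
... | h , inj₂ refl = OddPrime.primeFourSquares h p-prime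
... | h , inj₁ p≡h+h with prime⇒irreducible p-prime (divides {2} h (trans p≡h+h (ring h)))
  where
  ring : ∀ h → h + h ≡ h * 2
  ring = solve-∀
-- The alternative 2 = 1 is absurd, so an even prime is 2 = 1² + 1².
...   | inj₂ refl = fourSquares (+ 1) (+ 1) (+ 0) (+ 0) refl

product-fourSquares : ∀ {ps} → All Prime ps → FourSquares (product ps)
product-fourSquares []                   = fourSquares (+ 1) (+ 0) (+ 0) (+ 0) refl
product-fourSquares (p-prime ∷ ps-prime) =
  FourSquares-* (prime⇒fourSquares p-prime) (product-fourSquares ps-prime)

lagrange : ∀ n → FourSquares n
lagrange zero      = fourSquares (+ 0) (+ 0) (+ 0) (+ 0) refl
lagrange n@(suc _) = subst FourSquares (sym (isFactorisation factorisation))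
                                       (product-fourSquares (factorsPrime factorisation))
  where
  open PrimeFactorisation
  factorisation = factorise n

lagrange-ℕ : ∀ n → ∃[ a ] ∃[ b ] ∃[ c ] ∃[ d ] Σsq a b c d ≡ n
lagrange-ℕ n with fourSquares a b c d eq ← lagrange n
  = abs a , abs b , abs c , abs d , ℤ.+-injective (trans (sym (sum4-abs a b c d)) eq)

-- Representing all numbers from 76 n² on.

Γ-pair : ∀ n a → a ℕ.≤ 2 * n → + (18 * (n * n) + 2 * (a * a)) ∈ Γ n
Γ-pair n a a≤2n = subst (λ i → + i ∈ Γ n) eq
  (Γ-+ (Γ-sq (t + 2 * a) (≤-trans n≤t (m≤m+n t _))) (Γ-sq t n≤t))
  where
  -- The roots 3n - a and 3n + a appear as `t` and `t + 2 * a`, which keeps the ring identity free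
  -- of subtraction.
  t = 3 * n ∸ a
  n≤t : n ℕ.≤ t
  n≤t = m+n≤o⇒m≤o∸n n (+-monoʳ-≤ n a≤2n)
  ring₁ : ∀ t a → (t + 2 * a) * (t + 2 * a) + t * t ≡ 2 * ((t + a) * (t + a)) + 2 * (a * a)
  ring₁ = solve-∀
  ring₂ : ∀ n a → 2 * ((3 * n) * (3 * n)) + 2 * (a * a) ≡ 18 * (n * n) + 2 * (a * a)
  ring₂ = solve-∀
  t+a≡3n : t + a ≡ 3 * n
  t+a≡3n = m∸n+n≡m (≤-trans a≤2n (m≤n+m (2 * n) n))
  eq : (t + 2 * a) * (t + 2 * a) + t * t ≡ 18 * (n * n) + 2 * (a * a)
  eq = trans (ring₁ t a) (trans (cong (λ s → 2 * (s * s) + 2 * (a * a)) t+a≡3n) (ring₂ n a))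

-- Each root in a four-square representation of `h` has square at most h ≤ (2n)², hence is at most
-- 2n and admissible in `Γ-pair`.
Γ-even : ∀ n h → h ℕ.≤ 4 * (n * n) → + (72 * (n * n) + 2 * h) ∈ Γ n
Γ-even n h h≤4nn with a , b , c , d , refl ← lagrange-ℕ h =
  subst (λ i → + i ∈ Γ n) (ring (n * n) (a * a) (b * b) (c * c) (d * d))
    (Γ-+ (Γ-+ (Γ-pair n a (bound a (≤-trans (m≤m+n (a * a) (b * b)) (m≤m+n _ _))))
              (Γ-pair n b (bound b (≤-trans (m≤n+m (b * b) (a * a)) (m≤m+n _ _)))))
         (Γ-+ (Γ-pair n c (bound c (≤-trans (m≤m+n (c * c) (d * d)) (m≤n+m _ (a * a + b * b)))))
              (Γ-pair n d (bound d (≤-trans (m≤n+m (d * d) (c * c)) (m≤n+m _ (a * a + b * b)))))))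
  where
  ring : ∀ N a b c d → 18 * N + 2 * a + (18 * N + 2 * b) + (18 * N + 2 * c + (18 * N + 2 * d)) ≡
                       72 * N + 2 * (a + b + (c + d))
  ring = solve-∀
  double-square : ∀ n → 4 * (n * n) ≡ (2 * n) * (2 * n)
  double-square = solve-∀
  bound : ∀ x → x * x ℕ.≤ Σsq a b c d → x ℕ.≤ 2 * n
  bound x xx≤h = m*m≤n*n⇒m≤n (≤-trans xx≤h (≤-trans h≤4nn (≤-reflexive (double-square n))))

-- The constant splits as 72 + 1 + 3: 72 n² for the four pairs, n² towards the square that fixes the
-- parity, and 3 n² as room for the odd case. Dividing the excess by n² leaves `r` and `q` further
-- copies of n².
Γ-above-76n² : ∀ n .{{_ : NonZero n}} m → 76 * (n * n) ℕ.≤ m → + m ∈ Γ n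
Γ-above-76n² n m 76nn≤m = represent (parity (3 * N + r))
  where
  N = n * n
  instance _ = m*n≢0 n n
  e = m ∸ 76 * N
  r = e % N
  q = e / N

  m≡ : q * N + (73 * N + (3 * N + r)) ≡ m
  m≡ = begin
    q * N + (73 * N + (3 * N + r))  ≡⟨ ring (q * N) N r ⟩
    76 * N + (r + q * N)            ≡⟨ cong (λ e → 76 * N + e) (m≡m%n+[m/n]*n e N) ⟨
    76 * N + e                      ≡⟨ m+[n∸m]≡n 76nn≤m ⟩
    m                               ∎
    where
    open ≡-Reasoning
    ring : ∀ x N r → x + (73 * N + (3 * N + r)) ≡ 76 * N + (r + x)
    ring = solve-∀

  3N+r≤4N : 3 * N + r ℕ.≤ 4 * N
  3N+r≤4N = subst (3 * N + r ℕ.≤_) (+-comm (3 * N) N) (+-monoʳ-≤ (3 * N) (<⇒≤ (m%n<n e N)))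

  add-nn : ∀ {a} → + a ∈ Γ n → 73 * N + (3 * N + r) ≡ a → + m ∈ Γ n
  add-nn {a} a∈ eq = subst (λ i → + i ∈ Γ n) (trans (cong (_+_ (q * N)) (sym eq)) m≡)
                           (Γ-+ (Γ-* q (Γ-sq n ≤-refl)) a∈)

  represent : ∃[ h ] (3 * N + r ≡ h + h ⊎ 3 * N + r ≡ suc (h + h)) → + m ∈ Γ n
  represent (h , inj₁ eq) =
    add-nn (Γ-cons n ≤-refl (Γ-even n h h≤4N)) (trans (cong (_+_ (73 * N)) eq) (ring N h))
    where
    h≤4N = ≤-trans (m≤m+n h h) (≤-trans (≤-reflexive (sym eq)) 3N+r≤4N)
    ring : ∀ N h → 73 * N + (h + h) ≡ N + (72 * N + 2 * h)
    ring = solve-∀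
  -- As (n + 1)² = n² + 2n + 1, this square takes 2n + 1 out of 2h + 1 and leaves the even number 2
  -- (h - n).
  represent (h , inj₂ eq) =
    add-nn (Γ-cons (suc n) (n≤1+n n) (Γ-even n (h ∸ n) (≤-trans (m∸n≤m h n) h≤4N)))
      (trans (cong (_+_ (73 * N)) (trans eq (cong (λ h → suc (h + h)) (sym (m+[n∸m]≡n n≤h)))))
             (ring n (h ∸ n)))
    where
    h≤4N = ≤-trans (m≤m+n h h) (≤-trans (n≤1+n _) (≤-trans (≤-reflexive (sym eq)) 3N+r≤4N))
    ring : ∀ n j → 73 * (n * n) + suc (n + j + (n + j)) ≡ suc n * suc n + (72 * (n * n) + 2 * j)
    ring = solve-∀
    n≤N : n ℕ.≤ N
    n≤N = m≤m*n n n
    n≤h : n ℕ.≤ h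
    -- Here the reserved 3 n² is used: h < n would give 2h + 1 < 2n ≤ 3 n² ≤ 2h + 1.
    n≤h = ≮⇒≥ λ h<n → <-irrefl (sym eq) (begin-strict
      suc (h + h)  ≡⟨ +-suc h h ⟨
      h + suc h    <⟨ +-mono-<-≤ h<n h<n ⟩
      n + n        ≤⟨ +-mono-≤ n≤N (≤-trans n≤N (m≤m+n N _)) ⟩
      3 * N        ≤⟨ m≤m+n (3 * N) r ⟩
      3 * N + r    ∎)
      where open ≤-Reasoning

theorem1 : ∃[ C ] C > 0 × (∀ (n : ℕ) .{{_ : NonZero n}} → F n ≤ + (C * n ^ 2))
theorem1 = 76 , z<s , λ n → bound n (F n) (proj₁ (F-isGreatest n))
  where
  n*n≡n^2 : ∀ n → n * n ≡ n ^ 2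
  n*n≡n^2 n = cong (n *_) (sym (*-identityʳ n))
  bound : ∀ n .{{_ : NonZero n}} f → f ∉ Γ n → f ≤ + (76 * n ^ 2)
  -- `F n` is generalised to any `f` outside `Γ n` so that its sign can be matched on. The negative
  -- case does occur, at n = 1.
  bound n ℤ.-[1+ _ ] _  = ℤ.-≤+
  bound n (+ m)      m∉ = ℤ.+≤+ (subst (λ s → m ℕ.≤ 76 * s) (n*n≡n^2 n)
    (≮⇒≥ λ 76nn<m → m∉ (Γ-above-76n² n m (<⇒≤ 76nn<m))))
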